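{- (Structure Theorem of Tropical Convexity.) Let $V=(v_{ij})$ be a $d\times n$-matrix with entries in $\mathbb R\cup\{\infty\}$ such that no column has all entries equal to $\infty$. The covector decomposition $\mathcal T(V)$ of $\mathbb R^d$ is dual to the regular subdivision of the polytope $$\operatorname{conv}\{(e_i,e_j)\in\mathbb R^d\times\mathbb R^n : (i,j)\in \mathrm B(V)\}$$ with weights given by $V$. Moreover, the covector decomposition of $\operatorname{tcone}(V)$ is dual to the poset of interior cells of this subdivision.
   Context: $\mathbb T_{\min}=\mathbb R\cup\{\infty\}$ with $\oplus=\min$, $\odot=+$. $\mathrm B(V)=\{(i,j)\in[d]\times[n] : v_{ij}\ne\infty\}$, viewed as a bipartite graph on the disjoint union of $[d]$ and $[n]$. $v^{(j)}$ denotes the $j$th column of $V$, and $e_i$ standard basis vectors. For $u\in\mathbb T_{\min}^d$ and $i$ with $u_i\neq\infty$ the $i$th sector is $S_i(u)=\{z\in\mathbb R^d : z_\ell-z_i\le u_\ell-u_i \text{ for all } \ell\in[d] \text{ with } u_\ell\ne\infty\}$. The sectors $S_i(u)$ with $u_i\ne\infty$ are the maximal cells of a polyhedral complex $\Delta(u)$ covering $\mathbb R^d$ (its cells are the intersections of nonempty families of these sectors). The covector decomposition $\mathcal T(V)$ is the common refinement of $\Delta(v^{(1)}),\dots,\Delta(v^{(n)})$; equivalently, its cells are the nonempty sets $X_G(V)=\bigcap_{(i,j)\in G}S_i(v^{(j)})$ where $G\subseteq \mathrm B(V)$ has no isolated node in $[n]$. $\operatorname{tcone}(V)=\{(\lambda_1\odot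 v^{(1)})\oplus\dots\oplus(\lambda_n\odot v^{(n)}) : \lambda_j\in\mathbb T_{\min}\}$; its covector decomposition consists of the cells of $\mathcal T(V)$ contained in $\operatorname{tcone}(V)$. The regular subdivision with weights $V$ is obtained by lifting each point $(e_i,e_j)$, $(i,j)\in \mathrm B(V)$, to height $v_{ij}$ and projecting the lower faces of the convex hull of the lifted points. To each cell of the subdivision belongs the graph $G\subseteq \mathrm B(V)$ of all pairs $(i,j)$ whose lifted point lies on the corresponding lower face. Meaning of "dual": there is an inclusion-reversing bijection between the cells of $\mathcal T(V)$ and those cells of the subdivision whose graph has no isolated node in $[n]$, under which the cell with graph $G$ corresponds to $X_G(V)$. A cell of the subdivision is "interior" if it is not contained in the boundary of the product of simplices $\Delta_{d-1}\times\Delta_{n-1}=\operatorname{conv}\{(e_i,e_j): (i,j)\in[d]\times[n]\}$, i.e. if its graph has no isolated node in $[d]$ or in $[n]$; the second statement asserts that the bijection restricts to one between the cells of $\mathcal T(V)$ contained in $\operatorname{tcone}(V)$ and the interior cells. -}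

module Defs where

open import Algebra.Bundles using (CommutativeRing)
import Algebra.Construct.NaturalChoice.Min as Min
import Algebra.Properties.Monoid.Sum as Sum
open import Data.Bool.Base using (if_then_else_)
open import Data.Fin.Base using (Fin)
open import Data.Fin.Properties using (_≟_)
open import Data.Maybe using (Is-just; to-witness)
open import Data.Nat.Base as ℕ using (ℕ; suc)
open import Data.Product.Base using (Σ; Σ-syntax; ∃-syntax; _×_; _,_; proj₁; proj₂)
open import Data.Vec.Functional as Vector
  using (Vector; _∷_; _++_; head; tail; transpose)
open import Function.Base using (_on_; flip)
open import Level using (0ℓ)
open import Relation.Binary.Bundles using (TotalOrder)
import Relation.Binary.Construct.Add.Supremum.Equality as SupremumEquality
import Relation.Binary.Construct.Add.Supremum.NonStrict as SupremumOrder
import Relation.Binary.Construct.NonStrictToStrict as NonStrictToStrict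
open import Relation.Binary.Core using (Rel; _Preserves₂_⟶_⟶_)
open import Relation.Binary.Morphism.Structures using (IsOrderIsomorphism)
open import Relation.Binary.Structures using (IsDecTotalOrder)
open import Relation.Nullary.Construct.Add.Supremum using (_⁺; [_]; ⊤⁺)
open import Relation.Nullary.Decidable.Core using (does)
open import Relation.Nullary.Negation.Core using (¬_)
open import Relation.Unary
  using (Pred; _∈_; _⊆_; _≐_; Satisfiable; ⋂)

-- The real numbers, axiomatised up to isomorphism as a Dedekind-complete
-- ordered field.  The order is decidable and a supremum is approximated by
-- elements of the set, as in classical analysis; together these axioms imply
-- excluded middle for Set₀, and conversely excluded middle yields a model.

record Reals : Set₁ where
  field
    commutativeRing : CommutativeRing 0ℓ 0ℓ

  open CommutativeRing commutativeRing public

  infix 4 _≤_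

  field
    _≤_             : Rel Carrier 0ℓ
    isDecTotalOrder : IsDecTotalOrder _≈_ _≤_

  open NonStrictToStrict _≈_ _≤_ public using (_<_)

  field
    0≉1         : ¬ 0# ≈ 1#
    inverse     : ∀ x → ¬ x ≈ 0# → ∃[ y ] x * y ≈ 1#
    +-mono-≤    : _+_ Preserves₂ _≤_ ⟶ _≤_ ⟶ _≤_
    *-nonneg    : ∀ {x y} → 0# ≤ x → 0# ≤ y → 0# ≤ x * y
    supremum    : (P : Pred Carrier 0ℓ) → Satisfiable P →
                  (∃[ b ] ∀ {x} → x ∈ P → x ≤ b) →
                  ∃[ s ] (∀ {x} → x ∈ P → x ≤ s) ×
                         (∀ {y} → y < s → ∃[ x ] x ∈ P × y < x)

  totalOrder : TotalOrder 0ℓ 0ℓ 0ℓ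
  totalOrder = record
    { isTotalOrder = IsDecTotalOrder.isTotalOrder isDecTotalOrder }

module TropicalConvexity (R : Reals) where

  open Reals R renaming (Carrier to ℝ)
  open Sum +-monoid using (sum; sum-syntax)

  private
    variable
      d n m : ℕ

  ℝ^_ : ℕ → Set
  ℝ^ m = Vector ℝ m

  infix 4 _≋_

  _≋_ : Rel (ℝ^ m) 0ℓ
  x ≋ y = ∀ k → x k ≈ y k

  𝕋 : Set
  𝕋 = ℝ ⁺

  pattern ∞ = ⊤⁺

  open SupremumEquality _≈_ public using (_≈⁺_)

  𝕋-totalOrder : TotalOrder 0ℓ 0ℓ 0ℓ
  𝕋-totalOrder = record
    { isTotalOrder =
        SupremumOrder.≤⁺-isTotalOrder _≤_ (TotalOrder.isTotalOrder totalOrder) }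

  open Min 𝕋-totalOrder public renaming (_⊓_ to infixl 6 _⊕_) using ()

  infixl 7 _⊙_

  _⊙_ : 𝕋 → 𝕋 → 𝕋
  [ x ] ⊙ [ y ] = [ x + y ]
  [ x ] ⊙ ∞     = ∞
  ∞     ⊙ _     = ∞

  Finite : Pred 𝕋 0ℓ
  Finite = Is-just

  value : {t : 𝕋} → Finite t → ℝ
  value = to-witness

  Matrix : ℕ → ℕ → Set
  Matrix d n = Vector (Vector 𝕋 n) d

  column : Matrix d n → Fin n → Vector 𝕋 d
  column = transpose

  B : Matrix d n → Pred (Fin d × Fin n) 0ℓ
  B V (i , j) = Finite (V i j)

  sector : (u : Vector 𝕋 d) (i : Fin d) → Finite (u i) → Pred (ℝ^ d) 0ℓ
  sector u i uᵢ z = ∀ ℓ (uₗ : Finite (u ℓ)) → z ℓ - z i ≤ value uₗ - value uᵢ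

  IsΔCell : Vector 𝕋 d → Pred (ℝ^ d) 0ℓ → Set₁
  IsΔCell {d} u C =
    Σ[ I ∈ Pred (Fin d) 0ℓ ] Satisfiable I ×
    Σ[ finite ∈ (∀ i → i ∈ I → Finite (u i)) ]
      C ≐ (λ z → ∀ i (i∈I : i ∈ I) → z ∈ sector u i (finite i i∈I))

  -- The common refinement of the complexes Δ(v⁽ʲ⁾).
  IsCovectorCell : Matrix d n → Pred (ℝ^ d) 0ℓ → Set₁
  IsCovectorCell {d} {n} V D =
    Satisfiable D ×
    Σ[ C ∈ (Fin n → Pred (ℝ^ d) 0ℓ) ]
      (∀ j → IsΔCell (column V j) (C j)) × D ≐ ⋂ (Fin n) C

  CovectorCell : Matrix d n → Set₁
  CovectorCell V = Σ (Pred (ℝ^ _) 0ℓ) (IsCovectorCell V)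

  X : (V : Matrix d n) (G : Pred (Fin d × Fin n) 0ℓ) → G ⊆ B V → Pred (ℝ^ d) 0ℓ
  X V G G⊆B z =
    ∀ i j (ij∈G : (i , j) ∈ G) → z ∈ sector (column V j) i (G⊆B ij∈G)

  tcone : Matrix d n → Pred (Vector 𝕋 d) 0ℓ
  tcone {n = n} V u =
    Σ[ c ∈ Vector 𝕋 n ] ∀ i →
      u i ≈⁺ Vector.foldr _⊕_ ∞ (λ j → c j ⊙ V i j)

  InTcone : (V : Matrix d n) → Pred (CovectorCell V) 0ℓ
  InTcone V (D , _) = ∀ {z} → z ∈ D → (λ i → [ z i ]) ∈ tcone V

  _·_ : ℝ^ m → ℝ^ m → ℝ
  _·_ {m} c x = ∑[ k < m ] (c k * x k)

  conv : Pred (ℝ^ m) 0ℓ → Pred (ℝ^ m) 0ℓ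
  conv {m} S x =
    ∃[ r ] Σ[ p ∈ (Fin r → ℝ^ m) ] Σ[ w ∈ (Fin r → ℝ) ]
      (∀ t → p t ∈ S) × (∀ t → 0# ≤ w t) × sum w ≈ 1# ×
      x ≋ (λ k → ∑[ t < r ] (w t * p t k))

  -- The face of P on which the linear functional c is minimal.
  face : Pred (ℝ^ m) 0ℓ → ℝ^ m → Pred (ℝ^ m) 0ℓ
  face P c x = x ∈ P × (∀ {y} → y ∈ P → c · x ≤ c · y)

  -- The relative boundary: the union of the proper faces.
  ∂ : Pred (ℝ^ m) 0ℓ → Pred (ℝ^ m) 0ℓ
  ∂ P x = ∃[ c ] x ∈ face P c × ¬ (P ⊆ face P c)

  e : Fin m → ℝ^ m
  e i k = if does (i ≟ k) then 1# else 0#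

  Δ×Δ : ∀ d n → Pred (ℝ^ (d ℕ.+ n)) 0ℓ
  Δ×Δ d n = conv (λ x → ∃[ i ] ∃[ j ] x ≋ (e {d} i ++ e {n} j))

  -- Coordinate zero of ℝ^ (suc (d + n)) is the height.
  lift : (V : Matrix d n) (i : Fin d) (j : Fin n) → (i , j) ∈ B V →
         ℝ^ (suc (d ℕ.+ n))
  lift V i j vᵢⱼ = value vᵢⱼ ∷ (e i ++ e j)

  liftedPolytope : (V : Matrix d n) → Pred (ℝ^ (suc (d ℕ.+ n))) 0ℓ
  liftedPolytope V =
    conv (λ x → ∃[ i ] ∃[ j ] Σ[ b ∈ (i , j) ∈ B V ] x ≋ lift V i j b)

  IsLowerFace : Pred (ℝ^ (suc m)) 0ℓ → Pred (ℝ^ (suc m)) 0ℓ → Set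
  IsLowerFace P F = ∃[ c ] 0# < head c × F ≐ face P c

  project : Pred (ℝ^ (suc m)) 0ℓ → Pred (ℝ^ m) 0ℓ
  project F x = ∃[ y ] y ∈ F × x ≋ tail y

  -- A cell of the subdivision is given by the lower face it is the projection
  -- of; cells are compared via their projections, not via these faces.
  SubdivisionCell : Matrix d n → Set₁
  SubdivisionCell V = Σ (Pred _ 0ℓ) (IsLowerFace (liftedPolytope V))

  module _ {V : Matrix d n} where

    cell : SubdivisionCell V → Pred (ℝ^ (d ℕ.+ n)) 0ℓ
    cell (F , _) = project F

    graph : SubdivisionCell V → Pred (Fin d × Fin n) 0ℓ
    graph (F , _) (i , j) = Σ[ b ∈ (i , j) ∈ B V ] lift V i j b ∈ F

    graph⊆B : (σ : SubdivisionCell V) → graph σ ⊆ B V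
    graph⊆B _ = proj₁

  NoIsolatedColumn : (V : Matrix d n) → Pred (SubdivisionCell V) 0ℓ
  NoIsolatedColumn V σ = ∀ j → ∃[ i ] (i , j) ∈ graph σ

  Interior : (V : Matrix d n) → Pred (SubdivisionCell V) 0ℓ
  Interior {d} {n} V σ = ¬ (cell σ ⊆ ∂ (Δ×Δ d n))

  -- The cells of T(V) satisfying Q are dual, via G ↦ X_G(V), to the cells of
  -- the subdivision satisfying P.
  Dual : (V : Matrix d n) →
         Pred (CovectorCell V) 0ℓ → Pred (SubdivisionCell V) 0ℓ → Set₁
  Dual V Q P =
    Σ[ f ∈ (Σ (SubdivisionCell V) P → Σ (CovectorCell V) Q) ]
      (∀ σ → set (f σ) ≐ X V (graph (proj₁ σ)) (graph⊆B (proj₁ σ))) ×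
      IsOrderIsomorphism
        (_≐_ on (λ σ → cell (proj₁ σ))) (_≐_ on set)
        (_⊆_ on (λ σ → cell (proj₁ σ))) (flip (_⊆_ on set)) f
    where
    set : Σ (CovectorCell V) Q → Pred _ 0ℓ
    set D = proj₁ (proj₁ D)

{-# OPTIONS --safe #-}
module Submission where

-- For a point z of ℝᵈ let covector z be the bipartite graph of all (i , j) such
-- that i minimises v_ij - z_i in column j; then X_G is the set of z with
-- G ⊆ covector z.  A functional (1 , -z , -b) takes the value v_ij - z_i - b_j
-- at the lifted point of (i , j), so a lower face whose graph meets every column
-- has b_j = min_i (v_ij - z_i) up to a common constant, and its graph is
-- covector z.  Conversely the average of enough points of a cell X_G has the
-- smallest covector in the cell, and this covector is the graph of the
-- corresponding lower face.  Such a cell lies in tcone(V) exactly when its graph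
-- also has no isolated node in [d], since z lies in the tropical cone exactly
-- when covector z has none.

open import Defs
import Algebra.Construct.NaturalChoice.Min as Min
import Algebra.Properties.AbelianGroup as AbelianGroupProperties
import Algebra.Properties.CommutativeSemigroup as CommutativeSemigroupProperties
import Algebra.Properties.Ring as RingProperties
import Algebra.Properties.Semiring.Sum as SemiringSum
open import Data.Bool.Base using (true; false)
open import Data.Empty using (⊥-elim)
open import Data.Fin.Base using (Fin; zero; suc; _↑ˡ_; _↑ʳ_; splitAt; combine; remQuot)
open import Data.Fin.Properties as Fin using (remQuot-combine)
import Data.Maybe.Relation.Unary.Any as Maybe
open import Data.Nat.Base as ℕ using (ℕ; zero; suc; NonZero)
open import Data.Product.Base using (Σ-syntax; _×_; _,_; ∃-syntax; proj₁; proj₂)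
open import Data.Sum.Base using (_⊎_; inj₁; inj₂)
open import Data.Sum.Properties using ([,]-map)
open import Data.Vec.Functional using (Vector; _∷_; _++_; head; tail; foldr)
open import Data.Vec.Functional.Properties using (lookup-++ˡ; lookup-++ʳ)
open import Function.Base using (_∘_)
open import Level using (0ℓ)
import Relation.Binary.Construct.Add.Supremum.Equality as SupremumEquality
import Relation.Binary.Construct.Add.Supremum.NonStrict as SupremumOrder
import Relation.Binary.Reasoning.PartialOrder as PartialOrderReasoning
open import Relation.Binary.Bundles using (Poset; TotalOrder)
open import Relation.Binary.PropositionalEquality as ≡ using (_≡_)
open import Relation.Binary.Structures using (IsDecTotalOrder)
open import Relation.Nullary.Construct.Add.Supremum using ([_])
open import Relation.Nullary.Decidable.Core using (Dec; yes; no; does; decidable-stable)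
open import Relation.Nullary.Negation.Core using (¬_)
open import Relation.Unary using (Pred; _∈_; _⊆_; _≐_; Satisfiable; U)

-- Order and arithmetic of the reals.

module OrderedField (R : Reals) where

  open Reals R hiding (zero) renaming (Carrier to ℝ)
  open IsDecTotalOrder isDecTotalOrder public
    using (total; antisym; _≟_)
    renaming (refl to ≤-refl; reflexive to ≤-reflexive; trans to ≤-trans;
              _≤?_ to infix 4 _≤?_)
  open AbelianGroupProperties +-abelianGroup using (//-rightDividesˡ; //-rightDividesʳ)
  open RingProperties ring using (-‿distribˡ-*; -‿involutive)
  open SemiringSum semiring using (sum; sum-cong-≋; ∑-distrib-+; *-distribʳ-sum)

  ≤-poset : Poset 0ℓ 0ℓ 0ℓ
  ≤-poset = record
    { isPartialOrder = IsDecTotalOrder.isPartialOrder isDecTotalOrder }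

  open PartialOrderReasoning ≤-poset

  private
    variable
      n : ℕ
      x y z : ℝ

  ≰⇒≥ : ¬ x ≤ y → y ≤ x
  ≰⇒≥ {x} {y} x≰y with total x y
  ... | inj₁ x≤y = ⊥-elim (x≰y x≤y)
  ... | inj₂ y≤x = y≤x

  +-cancelʳ-≤ : ∀ z → x + z ≤ y + z → x ≤ y
  +-cancelʳ-≤ {x} {y} z x+z≤y+z = begin
    x          ≈⟨ //-rightDividesʳ z x ⟨
    x + z - z  ≤⟨ +-mono-≤ x+z≤y+z ≤-refl ⟩
    y + z - z  ≈⟨ //-rightDividesʳ z y ⟩
    y          ∎

  private
    -‿+-shift : ∀ a b c → (a - b) + (b + c) ≈ a + c
    -‿+-shift a b c = trans (sym (+-assoc _ _ _)) (+-congʳ (//-rightDividesˡ b a))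

    -‿+-shift′ : ∀ a b c → (a - b) + (c + b) ≈ a + c
    -‿+-shift′ a b c = trans (+-congˡ (+-comm c b)) (-‿+-shift a b c)

  x+w≤z+y⇒x-y≤z-w : ∀ {w} → x + w ≤ z + y → x - y ≤ z - w
  x+w≤z+y⇒x-y≤z-w {x} {z} {y} {w} x+w≤z+y = +-cancelʳ-≤ (y + w) (begin
    (x - y) + (y + w)  ≈⟨ -‿+-shift x y w ⟩
    x + w              ≤⟨ x+w≤z+y ⟩
    z + y              ≈⟨ -‿+-shift′ z w y ⟨
    (z - w) + (y + w)  ∎)

  -- A rearrangement that is its own inverse: it passes between the sector inequality
  -- `z ℓ - z i ≤ u ℓ - u i` and the comparison `u i - z i ≤ u ℓ - z ℓ`.
  x-y≤z-w⇒w-y≤z-x : ∀ {w} → x - y ≤ z - w → w - y ≤ z - x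
  x-y≤z-w⇒w-y≤z-x {x} {y} {z} {w} x-y≤z-w = x+w≤z+y⇒x-y≤z-w (begin
    w + x              ≈⟨ +-comm w x ⟩
    x + w              ≈⟨ -‿+-shift x y w ⟨
    (x - y) + (y + w)  ≤⟨ +-mono-≤ x-y≤z-w ≤-refl ⟩
    (z - w) + (y + w)  ≈⟨ -‿+-shift′ z w y ⟩
    z + y              ∎)

  x≤y-z⇒z≤y-x : x ≤ y - z → z ≤ y - x
  x≤y-z⇒z≤y-x {x} {y} {z} x≤y-z = +-cancelʳ-≤ x (begin
    z + x        ≤⟨ +-mono-≤ ≤-refl x≤y-z ⟩
    z + (y - z)  ≈⟨ +-comm z (y - z) ⟩
    y - z + z    ≈⟨ //-rightDividesˡ z y ⟩
    y            ≈⟨ //-rightDividesˡ x y ⟨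
    y - x + x    ∎)

  x-y≤z⇒x-z≤y : x - y ≤ z → x - z ≤ y
  x-y≤z⇒x-z≤y {x} {y} {z} x-y≤z = +-cancelʳ-≤ z (begin
    x - z + z  ≈⟨ //-rightDividesˡ z x ⟩
    x          ≈⟨ //-rightDividesˡ y x ⟨
    x - y + y  ≤⟨ +-mono-≤ x-y≤z ≤-refl ⟩
    z + y      ≈⟨ +-comm z y ⟩
    y + z      ∎)

  x≤y⇒0≤y-x : x ≤ y → 0# ≤ y - x
  x≤y⇒0≤y-x {x} {y} x≤y = begin
    0#     ≈⟨ -‿inverseʳ x ⟨
    x - x  ≤⟨ +-mono-≤ x≤y ≤-refl ⟩
    y - x  ∎

  *-monoˡ-≤ : 0# ≤ z → x ≤ y → z * x ≤ z * y
  *-monoˡ-≤ {z} {x} {y} 0≤z x≤y = begin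
    z * x                ≈⟨ +-identityˡ _ ⟨
    0# + z * x           ≤⟨ +-mono-≤ (*-nonneg 0≤z (x≤y⇒0≤y-x x≤y)) ≤-refl ⟩
    z * (y - x) + z * x  ≈⟨ distribˡ z (y - x) x ⟨
    z * (y - x + x)      ≈⟨ *-congˡ (//-rightDividesˡ x y) ⟩
    z * y                ∎

  *-cancelˡ : ¬ z ≈ 0# → z * x ≈ z * y → x ≈ y
  *-cancelˡ {z} {x} {y} z≉0 zx≈zy = begin-equality
    x            ≈⟨ unfold x ⟩
    g * (z * x)  ≈⟨ *-congˡ zx≈zy ⟩
    g * (z * y)  ≈⟨ unfold y ⟨
    y            ∎
    where
    g = proj₁ (inverse z z≉0)
    unfold : ∀ x → x ≈ g * (z * x)
    unfold x = begin-equality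
      x            ≈⟨ *-identityˡ x ⟨
      1# * x       ≈⟨ *-congʳ (proj₂ (inverse z z≉0)) ⟨
      z * g * x    ≈⟨ *-congʳ (*-comm z g) ⟩
      g * z * x    ≈⟨ *-assoc g z x ⟩
      g * (z * x)  ∎

  *-cancelˡ-≤ : 0# ≤ z → ¬ z ≈ 0# → z * x ≤ z * y → x ≤ y
  *-cancelˡ-≤ {z} {x} {y} 0≤z z≉0 zx≤zy with total x y
  ... | inj₁ x≤y = x≤y
  ... | inj₂ y≤x =
    ≤-reflexive (*-cancelˡ z≉0 (antisym zx≤zy (*-monoˡ-≤ 0≤z y≤x)))

  0≤1 : 0# ≤ 1#
  0≤1 with total 0# 1#
  ... | inj₁ 0≤1 = 0≤1
  ... | inj₂ 1≤0 = begin
    0#               ≤⟨ *-nonneg 0≤-1 0≤-1 ⟩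
    (- 1#) * (- 1#)  ≈⟨ -‿distribˡ-* 1# (- 1#) ⟨
    - (1# * - 1#)    ≈⟨ -‿cong (*-identityˡ (- 1#)) ⟩
    - - 1#           ≈⟨ -‿involutive 1# ⟩
    1#               ∎
    where
    0≤-1 : 0# ≤ - 1#
    0≤-1 = ≤-trans (x≤y⇒0≤y-x 1≤0) (≤-reflexive (+-identityˡ (- 1#)))

  -- The set {0} ∪ {1 : A} has a positive supremum exactly when A holds.
  excludedMiddle : (A : Set) → Dec A
  excludedMiddle A
    with supremum (λ x → x ≈ 0# ⊎ (x ≈ 1# × A)) (0# , inj₁ refl)
           (1# , λ { (inj₁ x≈0) → ≤-trans (≤-reflexive x≈0) 0≤1
                   ; (inj₂ (x≈1 , _)) → ≤-reflexive x≈1 })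
  ... | s , upper , approx with s ≤? 0#
  ...   | yes s≤0 = no λ a →
            0≉1 (antisym 0≤1 (≤-trans (upper (inj₂ (refl , a))) s≤0))
  ...   | no s≰0 with approx (≰⇒≥ s≰0 , λ 0≈s → s≰0 (≤-reflexive (sym 0≈s)))
  ...     | x , inj₁ x≈0 , _ , 0≉x = ⊥-elim (0≉x (sym x≈0))
  ...     | x , inj₂ (_ , a) , _ = yes a

  inverse-nonneg : 0# ≤ x → x * y ≈ 1# → 0# ≤ y
  inverse-nonneg {x} {y} 0≤x xy≈1 = *-cancelˡ-≤ 0≤x x≉0 (begin
    x * 0#  ≈⟨ zeroʳ x ⟩
    0#      ≤⟨ 0≤1 ⟩
    1#      ≈⟨ xy≈1 ⟨
    x * y   ∎)
    where
    x≉0 : ¬ x ≈ 0#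
    x≉0 x≈0 = 0≉1 (trans (sym (zeroˡ y)) (trans (*-congʳ (sym x≈0)) xy≈1))

  -- Finite sums and convex weights.

  sum-mono-≤ : {f g : Fin n → ℝ} → (∀ t → f t ≤ g t) → sum f ≤ sum g
  sum-mono-≤ {zero}  f≤g = ≤-refl
  sum-mono-≤ {suc n} f≤g = +-mono-≤ (f≤g zero) (sum-mono-≤ (f≤g ∘ suc))

  -- Slack in one term cannot be made up by the other terms, which obey the same bound.
  sum-tight : {f g : Fin n → ℝ} → (∀ t → f t ≤ g t) → sum g ≤ sum f →
              ∀ t → g t ≤ f t
  sum-tight {suc n} {f} {g} f≤g ∑g≤∑f zero = +-cancelʳ-≤ (sum (g ∘ suc))
    (≤-trans ∑g≤∑f (+-mono-≤ ≤-refl (sum-mono-≤ (f≤g ∘ suc))))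
  sum-tight {suc n} {f} {g} f≤g ∑g≤∑f (suc t) =
    sum-tight (f≤g ∘ suc) (+-cancelʳ-≤ (g zero) (begin
      sum (g ∘ suc) + g zero  ≈⟨ +-comm _ _ ⟩
      sum g                   ≤⟨ ∑g≤∑f ⟩
      sum f                   ≤⟨ +-mono-≤ (f≤g zero) ≤-refl ⟩
      g zero + sum (f ∘ suc)  ≈⟨ +-comm _ _ ⟩
      sum (f ∘ suc) + g zero  ∎)) t

  module _ {w : Fin n → ℝ} (0≤w : ∀ t → 0# ≤ w t) where

    -- The bound is asked for only where the weight is nonzero, since points of weight zero in a
    -- convex combination may lie off the face under consideration.
    weighted-mono-≤ : {f g : Fin n → ℝ} → (∀ t → ¬ w t ≈ 0# → f t ≤ g t) →
                      sum (λ t → w t * f t) ≤ sum (λ t → w t * g t)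
    weighted-mono-≤ {f} {g} f≤g = sum-mono-≤ bound
      where
      bound : ∀ t → w t * f t ≤ w t * g t
      bound t with w t ≟ 0#
      ... | no w≉0 = *-monoˡ-≤ (0≤w t) (f≤g t w≉0)
      ... | yes w≈0 = ≤-reflexive (begin-equality
        w t * f t  ≈⟨ *-congʳ w≈0 ⟩
        0# * f t   ≈⟨ zeroˡ _ ⟩
        0#         ≈⟨ zeroˡ _ ⟨
        0# * g t   ≈⟨ *-congʳ w≈0 ⟨
        w t * g t  ∎)

    -- The device behind three arguments: points supporting a point of a face lie on the face, an
    -- optimum at an average is an optimum at each averaged point, and vertices of a product of
    -- simplices are extreme.
    weighted-tight : {f g : Fin n → ℝ} → (∀ t → f t ≤ g t) →
                     sum (λ t → w t * g t) ≤ sum (λ t → w t * f t) →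
                     ∀ t → ¬ w t ≈ 0# → g t ≤ f t
    weighted-tight f≤g ∑wg≤∑wf t w≉0 = *-cancelˡ-≤ (0≤w t) w≉0
      (sum-tight (λ t → *-monoˡ-≤ (0≤w t) (f≤g t)) ∑wg≤∑wf t)

  weighted-const : (w : Fin n → ℝ) → sum w ≈ 1# → ∀ x → sum (λ t → w t * x) ≈ x
  weighted-const w ∑w≈1 x = begin-equality
    sum (λ t → w t * x)  ≈⟨ *-distribʳ-sum x w ⟨
    sum w * x            ≈⟨ *-congʳ ∑w≈1 ⟩
    1# * x               ≈⟨ *-identityˡ x ⟩
    x                    ∎

  weighted-minus : (w : Fin n → ℝ) → sum w ≈ 1# → ∀ x (f : Fin n → ℝ) →
                   sum (λ t → w t * (x - f t)) ≈ x - sum (λ t → w t * f t)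
  weighted-minus {n} w ∑w≈1 x f = begin-equality
    sum wx-f                      ≈⟨ //-rightDividesʳ (sum wf) (sum wx-f) ⟨
    sum wx-f + sum wf - sum wf    ≈⟨ +-congʳ (∑-distrib-+ wx-f wf) ⟨
    sum wx-f+wf - sum wf          ≈⟨ +-congʳ (sum-cong-≋ {n} {wx-f+wf} recombine) ⟩
    sum (λ t → w t * x) - sum wf  ≈⟨ +-congʳ (weighted-const w ∑w≈1 x) ⟩
    x - sum wf                    ∎
    where
    wf wx-f wx-f+wf : Fin n → ℝ
    wf t      = w t * f t
    wx-f t    = w t * (x - f t)
    wx-f+wf t = wx-f t + wf t
    recombine : ∀ t → wx-f+wf t ≈ w t * x
    recombine t = trans (sym (distribˡ (w t) (x - f t) (f t)))
      (*-congˡ (//-rightDividesˡ (f t) x))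

  some-weight≉0 : {w : Fin n → ℝ} → sum w ≈ 1# → ∃[ t ] ¬ w t ≈ 0#
  some-weight≉0 {zero} 0≈1 = ⊥-elim (0≉1 0≈1)
  some-weight≉0 {suc n} {w} ∑w≈1 with w zero ≟ 0#
  ... | no w≉0 = zero , w≉0
  ... | yes w≈0 =
    let t , w≉0 = some-weight≉0 (trans (sym (trans (+-congʳ w≈0) (+-identityˡ _))) ∑w≈1)
    in suc t , w≉0

  -- Weights that vanish nowhere, so that `weighted-tight` applies to every point averaged with
  -- them.
  record Weights (n : ℕ) : Set where
    field
      weight   : Fin n → ℝ
      nonneg   : ∀ t → 0# ≤ weight t
      total≈1  : sum weight ≈ 1#
      weight≉0 : ∀ t → ¬ weight t ≈ 0#

  uniform : ∀ n → Weights (suc n)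
  uniform n = record
    { weight   = λ _ → h
    ; nonneg   = λ _ → inverse-nonneg 0≤N N*h≈1
    ; total≈1  = trans (sum-cong-≋ {suc n} (λ _ → sym (*-identityˡ h)))
                   (trans (sym (*-distribʳ-sum h ones)) N*h≈1)
    ; weight≉0 = λ _ h≈0 →
        0≉1 (trans (sym (zeroʳ N)) (trans (*-congˡ (sym h≈0)) N*h≈1))
    }
    where
    ones : Fin (suc n) → ℝ
    ones _ = 1#
    -- `N` is `suc n` as a real number, at least 1 and hence invertible; every weight is its inverse
    -- `h`.
    N = sum ones
    0≤∑1 : ∀ m → 0# ≤ sum {m} (λ _ → 1#)
    0≤∑1 zero    = ≤-refl
    0≤∑1 (suc m) = ≤-trans (≤-reflexive (sym (+-identityˡ 0#))) (+-mono-≤ 0≤1 (0≤∑1 m))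
    0≤N = 0≤∑1 (suc n)
    1≤N : 1# ≤ N
    1≤N = ≤-trans (≤-reflexive (sym (+-identityʳ 1#))) (+-mono-≤ ≤-refl (0≤∑1 n))
    N≉0 : ¬ N ≈ 0#
    N≉0 N≈0 = 0≉1 (antisym 0≤1 (≤-trans 1≤N (≤-reflexive N≈0)))
    h = proj₁ (inverse N N≉0)
    N*h≈1 : N * h ≈ 1#
    N*h≈1 = proj₂ (inverse N N≉0)

-- Linear functionals, unit vectors and vertices of the product of simplices.

module DotProduct (R : Reals) where

  open TropicalConvexity R
  open Reals R hiding (zero) renaming (Carrier to ℝ)
  open OrderedField R
  open SemiringSum semiring
    using (sum; sum-syntax; sum-cong-≋; sum-replicate-zero; *-distribˡ-sum; ∑-comm)
  open PartialOrderReasoning ≤-poset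

  private
    variable
      d n m r : ℕ
      x y : ℝ^ m

  ≋-sym : x ≋ y → y ≋ x
  ≋-sym x≋y k = sym (x≋y k)

  ≋-trans : ∀ {z : ℝ^ m} → x ≋ y → y ≋ z → x ≋ z
  ≋-trans x≋y y≋z k = trans (x≋y k) (y≋z k)

  combination : (w : Fin r → ℝ) (p : Fin r → ℝ^ m) → ℝ^ m
  combination {r} w p k = ∑[ t < r ] (w t * p t k)

  ·-congʳ : ∀ (c : ℝ^ m) → x ≋ y → c · x ≈ c · y
  ·-congʳ c x≋y = sum-cong-≋ (λ k → *-congˡ (x≋y k))

  ·-combination : ∀ (c : ℝ^ m) (w : Fin r → ℝ) p →
                  c · combination w p ≈ ∑[ t < r ] (w t * (c · p t))
  ·-combination {m} {r} c w p = begin-equality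
    ∑[ k < m ] (c k * ∑[ t < r ] (w t * p t k))
      ≈⟨ sum-cong-≋ (λ k → *-distribˡ-sum (c k) (λ t → w t * p t k)) ⟩
    ∑[ k < m ] ∑[ t < r ] (c k * (w t * p t k))
      ≈⟨ ∑-comm (λ k t → c k * (w t * p t k)) ⟩
    ∑[ t < r ] ∑[ k < m ] (c k * (w t * p t k))
      ≈⟨ sum-cong-≋ (λ t → sum-cong-≋ (λ k → swap (c k) (w t) (p t k))) ⟩
    ∑[ t < r ] ∑[ k < m ] (w t * (c k * p t k))
      ≈⟨ sum-cong-≋ (λ t → *-distribˡ-sum (w t) (λ k → c k * p t k)) ⟨
    ∑[ t < r ] (w t * (c · p t))
      ∎
    where
    swap : ∀ x y z → x * (y * z) ≈ y * (x * z)
    swap x y z = trans (sym (*-assoc x y z)) (trans (*-congʳ (*-comm x y)) (*-assoc y x z))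

  ·-zeroʳ : ∀ (c : ℝ^ m) → c · (λ _ → 0#) ≈ 0#
  ·-zeroʳ {m} c = trans (sum-cong-≋ (λ k → zeroʳ (c k))) (sum-replicate-zero m)

  ·-e : ∀ (c : ℝ^ m) i → c · e i ≈ c i
  ·-e c zero = begin-equality
    c zero * 1# + (c ∘ suc) · (λ _ → 0#)  ≈⟨ +-cong (*-identityʳ _) (·-zeroʳ (c ∘ suc)) ⟩
    c zero + 0#                           ≈⟨ +-identityʳ _ ⟩
    c zero                                ∎
  ·-e c (suc i) = begin-equality
    c zero * 0# + (c ∘ suc) · e i  ≈⟨ +-cong (zeroʳ _) (·-e (c ∘ suc) i) ⟩
    0# + c (suc i)                 ≈⟨ +-identityˡ _ ⟩
    c (suc i)                      ∎

  ·-++ : ∀ (c : ℝ^ (d ℕ.+ n)) (x : ℝ^ d) (y : ℝ^ n) →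
         c · (x ++ y) ≈ (λ k → c (k ↑ˡ n)) · x + (λ k → c (d ↑ʳ k)) · y
  ·-++ {zero} c x y = sym (+-identityˡ _)
  ·-++ {suc d} {n} c x y = begin-equality
    c zero * x zero + (c ∘ suc) · ((x ++ y) ∘ suc)
      ≈⟨ +-congˡ (·-congʳ (c ∘ suc) (λ k → reflexive ([,]-map (splitAt d k)))) ⟩
    c zero * x zero + (c ∘ suc) · ((x ∘ suc) ++ y)
      ≈⟨ +-congˡ (·-++ (c ∘ suc) (x ∘ suc) y) ⟩
    c zero * x zero + ((λ k → c (suc k ↑ˡ n)) · (x ∘ suc) + (λ k → c (suc d ↑ʳ k)) · y)
      ≈⟨ +-assoc _ _ _ ⟨
    (λ k → c (k ↑ˡ n)) · x + (λ k → c (suc d ↑ʳ k)) · y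
      ∎

  e-diagonal : ∀ (i : Fin m) → e i i ≈ 1#
  e-diagonal i with i Fin.≟ i
  ... | yes _  = refl
  ... | no i≢i = ⊥-elim (i≢i ≡.refl)

  0≤e : ∀ (i k : Fin m) → 0# ≤ e i k
  0≤e i k with does (i Fin.≟ k)
  ... | true  = 0≤1
  ... | false = ≤-refl

  e≤1 : ∀ (i k : Fin m) → e i k ≤ 1#
  e≤1 i k with does (i Fin.≟ k)
  ... | true  = ≤-refl
  ... | false = 0≤1

  1≤e⇒≡ : ∀ {i k : Fin m} → 1# ≤ e i k → i ≡ k
  1≤e⇒≡ {i = i} {k} 1≤e with i Fin.≟ k
  ... | yes i≡k = i≡k
  ... | no _    = ⊥-elim (0≉1 (antisym 0≤1 1≤e))

  i≢k⇒e≈0 : ∀ (i k : Fin m) → ¬ i ≡ k → e i k ≈ 0#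
  i≢k⇒e≈0 i k i≢k with i Fin.≟ k
  ... | yes i≡k = ⊥-elim (i≢k i≡k)
  ... | no _    = refl

  module Vertex (d n : ℕ) where

    vertex : Fin d → Fin n → ℝ^ (d ℕ.+ n)
    vertex i j = e i ++ e j

    ·-vertex : ∀ (c : ℝ^ (d ℕ.+ n)) i j → c · vertex i j ≈ c (i ↑ˡ n) + c (d ↑ʳ j)
    ·-vertex c i j =
      trans (·-++ c (e i) (e j)) (+-cong (·-e (λ k → c (k ↑ˡ n)) i) (·-e (λ k → c (d ↑ʳ k)) j))

    ·-vertex-++ : ∀ (f : ℝ^ d) (g : ℝ^ n) i j → (f ++ g) · vertex i j ≈ f i + g j
    ·-vertex-++ f g i j = trans (·-vertex (f ++ g) i j)
      (reflexive (≡.cong₂ _+_ (lookup-++ˡ f g i) (lookup-++ʳ f g j)))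

    vertex≤1 : ∀ (i : Fin d) (j : Fin n) k → vertex i j k ≤ 1#
    vertex≤1 i j k with splitAt d k
    ... | inj₁ i′ = e≤1 i i′
    ... | inj₂ j′ = e≤1 j j′

  -- Convex hulls and their faces.

  module Convex {m} (S : Pred (ℝ^ m) 0ℓ) where

    private
      variable
        p q : ℝ^ m

    ∈⇒∈conv : p ∈ S → p ∈ conv S
    ∈⇒∈conv {p = p} p∈S =
      1 , (λ _ → p) , (λ _ → 1#) , (λ _ → p∈S) , (λ _ → 0≤1) , +-identityʳ 1# ,
      (λ k → sym (trans (+-identityʳ _) (*-identityˡ (p k))))

    conv-resp-≋ : p ≋ q → p ∈ conv S → q ∈ conv S
    conv-resp-≋ p≋q (r , v , w , v∈S , 0≤w , ∑w≈1 , p≋) =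
      r , v , w , v∈S , 0≤w , ∑w≈1 , ≋-trans (≋-sym p≋q) p≋

    conv-≥ : ∀ (c : ℝ^ m) {p b} → (∀ {s} → s ∈ S → b ≤ c · s) → p ∈ conv S → b ≤ c · p
    conv-≥ c {p} {b} b≤c (r , v , w , v∈S , 0≤w , ∑w≈1 , p≋) = begin
      b                             ≈⟨ weighted-const w ∑w≈1 b ⟨
      ∑[ t < r ] (w t * b)          ≤⟨ weighted-mono-≤ 0≤w (λ t _ → b≤c (v∈S t)) ⟩
      ∑[ t < r ] (w t * (c · v t))  ≈⟨ ·-combination c w v ⟨
      c · combination w v           ≈⟨ ·-congʳ c p≋ ⟨
      c · p                         ∎

    face-resp-≋ : ∀ c → p ≋ q → p ∈ face (conv S) c → q ∈ face (conv S) c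
    face-resp-≋ c p≋q (p∈P , c·p≤) =
      conv-resp-≋ p≋q p∈P , λ z∈P → ≤-trans (≤-reflexive (·-congʳ c (≋-sym p≋q))) (c·p≤ z∈P)

    combination∈face :
      ∀ c {w : Fin r → ℝ} {v : Fin r → ℝ^ m} → (∀ t → 0# ≤ w t) → sum w ≈ 1# →
      p ∈ conv S → p ≋ combination w v → (∀ t → ¬ w t ≈ 0# → v t ∈ face (conv S) c) →
      p ∈ face (conv S) c
    combination∈face {r} {p} c {w} {v} 0≤w ∑w≈1 p∈P p≋ v∈face = p∈P , λ {q} q∈P → begin
      c · p                         ≈⟨ ·-congʳ c p≋ ⟩
      c · combination w v           ≈⟨ ·-combination c w v ⟩
      ∑[ t < r ] (w t * (c · v t))  ≤⟨ weighted-mono-≤ 0≤w (λ t w≉0 → proj₂ (v∈face t w≉0) q∈P) ⟩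
      ∑[ t < r ] (w t * (c · q))    ≈⟨ weighted-const w ∑w≈1 (c · q) ⟩
      c · q                         ∎

    -- `c · p` is the average of the values `c · v t`, none of which is below it, so those of
    -- nonzero weight equal it.
    face-support :
      ∀ c {w : Fin r → ℝ} {v : Fin r → ℝ^ m} → (∀ t → v t ∈ S) → (∀ t → 0# ≤ w t) → sum w ≈ 1# →
      p ≋ combination w v → p ∈ face (conv S) c →
      ∀ t → ¬ w t ≈ 0# → v t ∈ face (conv S) c
    face-support {r} {p} c {w} {v} v∈S 0≤w ∑w≈1 p≋ (p∈P , c·p≤) t w≉0 =
      ∈⇒∈conv (v∈S t) , λ q∈P → ≤-trans c·v≤c·p (c·p≤ q∈P)
      where
      c·v≤c·p : c · v t ≤ c · p
      c·v≤c·p = weighted-tight 0≤w (λ t → c·p≤ (∈⇒∈conv (v∈S t))) (begin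
        ∑[ t < r ] (w t * (c · v t))  ≈⟨ ·-combination c w v ⟨
        c · combination w v           ≈⟨ ·-congʳ c p≋ ⟨
        c · p                         ≈⟨ weighted-const w ∑w≈1 (c · p) ⟨
        ∑[ t < r ] (w t * (c · p))    ∎) t w≉0

-- Tropical sums.

module Tropical (R : Reals) where

  open TropicalConvexity R
  open Reals R using (_≈_; _+_; _≤_) renaming (Carrier to ℝ)
  open SupremumEquality _≈_ using ([_])
  open SupremumOrder _≤_ using (_≤⊤⁺)
  module 𝕋 = TotalOrder 𝕋-totalOrder
  private module Min⁺ = Min 𝕋-totalOrder

  private
    variable
      n : ℕ
      t : 𝕋
      x : ℝ

  ⨁ : Vector 𝕋 n → 𝕋
  ⨁ = foldr _⊕_ ∞

  ⨁-≤ : (f : Vector 𝕋 n) → ∀ j → ⨁ f 𝕋.≤ f j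
  ⨁-≤ f zero    = Min⁺.x⊓y≤x (f zero) (⨁ (tail f))
  ⨁-≤ f (suc j) = 𝕋.trans (Min⁺.x⊓y≤y (f zero) (⨁ (tail f))) (⨁-≤ (tail f) j)

  ≤-⨁ : (f : Vector 𝕋 n) → (∀ j → t 𝕋.≤ f j) → t 𝕋.≤ ⨁ f
  ≤-⨁ {zero}  f t≤f = _ ≤⊤⁺
  ≤-⨁ {suc n} f t≤f = Min⁺.⊓-glb (t≤f zero) (≤-⨁ (tail f) (λ j → t≤f (suc j)))

  -- `⊕` returns one of its arguments and the empty sum is `∞`, so a finite value comes from a
  -- summand.
  ⨁-attained : (f : Vector 𝕋 n) → ⨁ f ≈⁺ [ x ] → ∃[ j ] f j ≈⁺ [ x ]
  ⨁-attained {zero} f ()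
  ⨁-attained {suc n} f ⨁f≈x with Min⁺.⊓-sel (f zero) (⨁ (tail f))
  ... | inj₁ ≈head = zero , 𝕋.Eq.trans (𝕋.Eq.sym ≈head) ⨁f≈x
  ... | inj₂ ≈tail =
    let j , fⱼ≈x = ⨁-attained (tail f) (𝕋.Eq.trans (𝕋.Eq.sym ≈tail) ⨁f≈x)
    in suc j , fⱼ≈x

  []⊙-value : (v : Finite t) → [ x ] ⊙ t ≡ [ x + value v ]
  []⊙-value (Maybe.just _) = ≡.refl

  ⊙-finite : ∀ s → s ⊙ t ≈⁺ [ x ] → ∃[ a ] s ≡ [ a ] × Σ[ v ∈ Finite t ] a + value v ≈ x
  ⊙-finite {t = [ b ]} [ a ] [ a+b≈x ] = a , ≡.refl , Maybe.just _ , a+b≈x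

module Structure (R : Reals) {d n : ℕ} (V : TropicalConvexity.Matrix R d n) where

  open TropicalConvexity R
  open Reals R hiding (zero) renaming (Carrier to ℝ)
  open OrderedField R
  open DotProduct R
  open Vertex d n
  open Tropical R
  open SupremumOrder _≤_ using ([_]; _≤⊤⁺; [≤]-injective)
  open CommutativeSemigroupProperties +-commutativeSemigroup using (interchange)
  open RingProperties ring using (-‿involutive)
  open SemiringSum semiring using (sum)
  open PartialOrderReasoning ≤-poset

  private
    variable
      i ℓ : Fin d
      j : Fin n

  -- Covectors and the cells of the covector decomposition.

  NoIsolatedNodeʳ : Pred (Pred (Fin d × Fin n) 0ℓ) 0ℓ
  NoIsolatedNodeʳ G = ∀ j → ∃[ i ] (i , j) ∈ G

  NoIsolatedNodeˡ : Pred (Pred (Fin d × Fin n) 0ℓ) 0ℓ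
  NoIsolatedNodeˡ G = ∀ i → ∃[ j ] (i , j) ∈ G

  -- `value` takes a finiteness proof, and graphs, covectors and sectors each carry their own; this
  -- identifies the resulting values.
  Finite-irrelevant : {t : 𝕋} (p q : Finite t) → p ≡ q
  Finite-irrelevant (Maybe.just _) (Maybe.just _) = ≡.refl

  cost : ℝ^ d → Finite (V i j) → ℝ
  cost {i} z v = value v - z i

  -- Node i is adjacent to j when z lies in the i-th sector of v⁽ʲ⁾, which says
  -- that v_ij - z_i is minimal in column j.
  covector : ℝ^ d → Pred (Fin d × Fin n) 0ℓ
  covector z (i , j) =
    Σ[ v ∈ Finite (V i j) ] ∀ {ℓ} (w : Finite (V ℓ j)) → cost z v ≤ cost z w

  sector⇒covector : ∀ {z} (v : Finite (V i j)) →
                    z ∈ sector (column V j) i v → (i , j) ∈ covector z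
  sector⇒covector v z∈S = v , λ {ℓ} w → x-y≤z-w⇒w-y≤z-x (z∈S ℓ w)

  covector⇒sector : ∀ {z} (v : Finite (V i j)) →
                    (i , j) ∈ covector z → z ∈ sector (column V j) i v
  covector⇒sector v (v′ , v′-min) ℓ w with ≡.refl ← Finite-irrelevant v v′ =
    x-y≤z-w⇒w-y≤z-x (v′-min w)

  X[_] : SubdivisionCell V → Pred (ℝ^ d) 0ℓ
  X[ σ ] = X V (graph σ) (graph⊆B σ)

  X⇒⊆covector : ∀ σ {z} → z ∈ X[ σ ] → graph σ ⊆ covector z
  X⇒⊆covector σ z∈X ij∈σ = sector⇒covector (proj₁ ij∈σ) (z∈X _ _ ij∈σ)

  ⊆covector⇒X : ∀ σ {z} → graph σ ⊆ covector z → z ∈ X[ σ ]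
  ⊆covector⇒X σ σ⊆z i j ij∈σ = covector⇒sector (proj₁ ij∈σ) (σ⊆z ij∈σ)

  -- Each cell `C j` comes with a nonempty index set; these sets become the neighbourhoods of the
  -- nodes `j` in `G`.
  covectorCell-graph : (D : CovectorCell V) →
    Σ[ G ∈ Pred (Fin d × Fin n) 0ℓ ] NoIsolatedNodeʳ G ×
      proj₁ D ≐ (λ z → G ⊆ covector z)
  covectorCell-graph (D , _ , C , C-cell , D≐⋂C) = G ,
    (λ j → proj₁ (proj₂ (C-cell j))) ,
    (λ {z} z∈D {ij} ij∈G → sector⇒covector (finite ij ij∈G) (to z∈D ij ij∈G)) ,
    (λ {z} G⊆ → proj₂ D≐⋂C (λ j → let _ , _ , finite , C≐ = C-cell j in
      proj₂ C≐ (λ i i∈I → covector⇒sector (finite i i∈I) (G⊆ i∈I))))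
    where
    G : Pred (Fin d × Fin n) 0ℓ
    G (i , j) = i ∈ proj₁ (C-cell j)
    finite : ∀ ij → ij ∈ G → ij ∈ B V
    finite (i , j) = proj₁ (proj₂ (proj₂ (C-cell j))) i
    to : ∀ {z} → z ∈ D → ∀ ij (ij∈G : ij ∈ G) →
         z ∈ sector (column V (proj₂ ij)) (proj₁ ij) (finite ij ij∈G)
    to z∈D (i , j) i∈I = proj₁ (proj₂ (proj₂ (proj₂ (C-cell j)))) (proj₁ D≐⋂C z∈D j) i i∈I

  X-covectorCell : (G : Pred (Fin d × Fin n) 0ℓ) (G⊆B : G ⊆ B V) → NoIsolatedNodeʳ G →
                   Satisfiable (X V G G⊆B) → IsCovectorCell V (X V G G⊆B)
  X-covectorCell G G⊆B isolated sat = sat ,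
    (λ j z → ∀ i (ij∈G : (i , j) ∈ G) → z ∈ sector (column V j) i (G⊆B ij∈G)) ,
    (λ j → (λ i → (i , j) ∈ G) , isolated j , (λ i → G⊆B) , (λ p → p) , (λ p → p)) ,
    (λ z∈X j i → z∈X i j) , (λ z∈⋂ i j → z∈⋂ j i)

  -- Averages of points and generic points.

  cost-combination : ∀ {r} (w : Fin r → ℝ) (zs : Fin r → ℝ^ d) → sum w ≈ 1# →
                     (v : Finite (V i j)) →
                     sum (λ t → w t * cost (zs t) v) ≈ cost (combination w zs) v
  cost-combination {i} w zs ∑w≈1 v = weighted-minus w ∑w≈1 (value v) (λ t → zs t i)

  module _ {r} (ω : Weights r) (zs : Fin r → ℝ^ d)
           {G : Pred (Fin d × Fin n) 0ℓ} (G⊆ : ∀ t → G ⊆ covector (zs t)) where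

    open Weights ω

    private
      z̄ = combination weight zs

    -- Costs are affine in the point, so optimality of an entry survives averaging; `t₀` supplies
    -- the finiteness proof of the entry.
    average⊇ : Fin r → G ⊆ covector z̄
    average⊇ t₀ ij∈G = v , λ w → begin
      cost z̄ v                              ≈⟨ cost-combination weight zs total≈1 v ⟨
      sum (λ t → weight t * cost (zs t) v)  ≤⟨ weighted-mono-≤ nonneg (λ t _ → v-min t w) ⟩
      sum (λ t → weight t * cost (zs t) w)  ≈⟨ cost-combination weight zs total≈1 w ⟩
      cost z̄ w                              ∎
      where
      v = proj₁ (G⊆ t₀ ij∈G)
      v-min : ∀ t {ℓ} (w : Finite (V ℓ _)) → cost (zs t) v ≤ cost (zs t) w
      v-min t w with v′ , v′-min ← G⊆ t ij∈G with ≡.refl ← Finite-irrelevant v v′ = v′-min w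

    -- Column `j` has an entry `v*` that is optimal at all points `zs s`. An entry optimal at the
    -- average costs no more than `v*` there, hence by tightness at each single point.
    average⊆ : NoIsolatedNodeʳ G → ∀ t → covector z̄ ⊆ covector (zs t)
    average⊆ nonisolated t {i , j} (v , v-min) = v , λ w → ≤-trans v≤v* (proj₂ (G⊆ t i*j∈G) w)
      where
      i*j∈G = proj₂ (nonisolated j)
      v* = proj₁ (G⊆ t i*j∈G)
      v*-min : ∀ s → cost (zs s) v* ≤ cost (zs s) v
      v*-min s with v′ , v′-min ← G⊆ s i*j∈G with ≡.refl ← Finite-irrelevant v* v′ = v′-min v
      v≤v* : cost (zs t) v ≤ cost (zs t) v*
      v≤v* = weighted-tight nonneg v*-min (begin
        sum (λ s → weight s * cost (zs s) v)   ≈⟨ cost-combination weight zs total≈1 v ⟩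
        cost z̄ v                               ≤⟨ v-min v* ⟩
        cost z̄ v*                              ≈⟨ cost-combination weight zs total≈1 v* ⟨
        sum (λ s → weight s * cost (zs s) v*)  ∎) t (weight≉0 t)

  -- A point in the relative interior of X_G: average over all pairs (i , j) a
  -- point of X_G outside the sector of (i , j), where there is one.
  generic-point : {G : Pred (Fin d × Fin n) 0ℓ} → NoIsolatedNodeʳ G →
    ∀ {z₀} → G ⊆ covector z₀ →
    ∃[ z ] G ⊆ covector z × (∀ {z′} → G ⊆ covector z′ → covector z ⊆ covector z′)
  generic-point {G} nonisolated {z₀} G⊆z₀ =
    combination weight zs , average⊇ (uniform (d ℕ.* n)) zs G⊆ zero , minimal
    where
    open Weights (uniform (d ℕ.* n))
    avoiding : ∀ ij → ∃[ z ] G ⊆ covector z ×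
               (ij ∈ covector z → ∀ {z′} → G ⊆ covector z′ → ij ∈ covector z′)
    avoiding ij with excludedMiddle (∃[ z ] G ⊆ covector z × ¬ ij ∈ covector z)
    ... | yes (z , G⊆z , ij∉) = z , G⊆z , λ ij∈ → ⊥-elim (ij∉ ij∈)
    ... | no none = z₀ , G⊆z₀ , λ _ {z′} G⊆z′ →
      decidable-stable (excludedMiddle _) (λ ij∉ → none (z′ , G⊆z′ , ij∉))
    zs : Fin (suc (d ℕ.* n)) → ℝ^ d
    -- `z₀` makes the family nonempty even if there are no pairs.
    zs zero    = z₀
    zs (suc t) = proj₁ (avoiding (remQuot n t))
    G⊆ : ∀ t → G ⊆ covector (zs t)
    G⊆ zero    = G⊆z₀
    G⊆ (suc t) = proj₁ (proj₂ (avoiding (remQuot n t)))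
    minimal : ∀ {z′} → G ⊆ covector z′ → covector (combination weight zs) ⊆ covector z′
    -- An edge present at the average is present at the point chosen to avoid it, so no point of the
    -- cell avoids it.
    minimal G⊆z′ {i , j} ij∈ = proj₂ (proj₂ (avoiding (i , j)))
      (≡.subst (λ ij → (i , j) ∈ covector (proj₁ (avoiding ij))) (remQuot-combine i j)
        (average⊆ (uniform (d ℕ.* n)) zs G⊆ nonisolated (suc (combine i j)) ij∈))
      G⊆z′

  -- Lower faces of the lifted polytope.

  Lifted : Pred (ℝ^ (suc (d ℕ.+ n))) 0ℓ
  Lifted x = ∃[ i ] ∃[ j ] Σ[ b ∈ (i , j) ∈ B V ] x ≋ lift V i j b

  module P = Convex Lifted

  lift∈Lifted : (b : (i , j) ∈ B V) → lift V i j b ∈ Lifted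
  lift∈Lifted b = _ , _ , b , λ _ → refl

  lift∈P : (b : (i , j) ∈ B V) → lift V i j b ∈ liftedPolytope V
  lift∈P b = P.∈⇒∈conv (lift∈Lifted b)

  ·-lift : ∀ c (b : (i , j) ∈ B V) →
           c · lift V i j b ≈ head c * value b + (tail c (i ↑ˡ n) + tail c (d ↑ʳ j))
  ·-lift c b = +-congˡ (·-vertex (tail c) _ _)

  graph⇒lift∈ : (σ : SubdivisionCell V) → (i , j) ∈ graph σ →
                (b : (i , j) ∈ B V) → lift V i j b ∈ proj₁ σ
  graph⇒lift∈ σ (b′ , lift∈F) b with ≡.refl ← Finite-irrelevant b b′ = lift∈F

  -- The point -a/c₀, where c = (c₀ , a , b) is a functional defining the lower
  -- face of σ.
  cell-point : (σ : SubdivisionCell V) → NoIsolatedColumn V σ →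
               ∃[ z ] graph σ ≐ covector z
  cell-point σ@(F , c , (0≤c₀ , 0≉c₀) , F⊆ , ⊆F) nonisolated =
    z , (λ {ij} → graph⇒covector ij) , (λ {ij} → covector⇒graph ij)
    where
    c₀ = head c
    c₀≉0 : ¬ c₀ ≈ 0#
    c₀≉0 c₀≈0 = 0≉c₀ (sym c₀≈0)
    g = proj₁ (inverse c₀ c₀≉0)
    a : ℝ^ d
    a i = tail c (i ↑ˡ n)
    z : ℝ^ d
    z i = - (g * a i)
    c₀*cost : (v : Finite (V i j)) → c₀ * cost z v ≈ c₀ * value v + a i
    c₀*cost {i} v = begin-equality
      c₀ * (value v - - (g * a i))       ≈⟨ *-congˡ (+-congˡ (-‿involutive _)) ⟩
      c₀ * (value v + g * a i)           ≈⟨ distribˡ _ _ _ ⟩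
      c₀ * value v + c₀ * (g * a i)      ≈⟨ +-congˡ (*-assoc _ _ _) ⟨
      c₀ * value v + c₀ * g * a i        ≈⟨ +-congˡ (*-congʳ (proj₂ (inverse c₀ c₀≉0))) ⟩
      c₀ * value v + 1# * a i            ≈⟨ +-congˡ (*-identityˡ _) ⟩
      c₀ * value v + a i                 ∎
    -- The last summand depends only on the column, so within a column lower height means lower
    -- cost.
    height : (v : Finite (V i j)) →
             c · lift V i j v ≈ c₀ * cost z v + tail c (d ↑ʳ j)
    height v = trans (·-lift c v) (trans (sym (+-assoc _ _ _)) (+-congʳ (sym (c₀*cost v))))
    graph⇒covector : ∀ ij → ij ∈ graph σ → ij ∈ covector z
    graph⇒covector (i , j) (v , lift∈F) = v , λ {ℓ} w →
      *-cancelˡ-≤ 0≤c₀ c₀≉0 (+-cancelʳ-≤ (tail c (d ↑ʳ j)) (begin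
        c₀ * cost z v + tail c (d ↑ʳ j)  ≈⟨ height v ⟨
        c · lift V i j v                 ≤⟨ proj₂ (F⊆ lift∈F) (lift∈P w) ⟩
        c · lift V ℓ j w                 ≈⟨ height w ⟩
        c₀ * cost z w + tail c (d ↑ʳ j)  ∎))
    covector⇒graph : ∀ ij → ij ∈ covector z → ij ∈ graph σ
    -- Column `j` has an edge `i*` on the face by assumption; an entry of minimal cost lies no
    -- higher, hence on the face too.
    covector⇒graph (i , j) (v , v-min) = v , ⊆F (lift∈P v , λ y∈P →
      let i* , v* , lift*∈F = nonisolated j in
      ≤-trans (begin
        c · lift V i j v                  ≈⟨ height v ⟩
        c₀ * cost z v + tail c (d ↑ʳ j)   ≤⟨ +-mono-≤ (*-monoˡ-≤ 0≤c₀ (v-min v*)) ≤-refl ⟩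
        c₀ * cost z v* + tail c (d ↑ʳ j)  ≈⟨ height v* ⟨
        c · lift V i* j v*                ∎) (proj₂ (F⊆ lift*∈F) y∈P))

  -- Subtracting the column minima `m j` makes the functional nonnegative at all lifted points and
  -- zero exactly at the edges of the covector.
  point-cell : ∀ z → NoIsolatedNodeʳ (covector z) →
               Σ[ σ ∈ SubdivisionCell V ] graph σ ≐ covector z
  point-cell z nonisolated =
    σ , (λ {ij} → graph⇒covector ij) , (λ {ij} → covector⇒graph ij)
    where
    m : ℝ^ n
    m j = cost z (proj₁ (proj₂ (nonisolated j)))
    m-min : ∀ j (w : Finite (V ℓ j)) → m j ≤ cost z w
    m-min j w = proj₂ (proj₂ (nonisolated j)) w
    c : ℝ^ (suc (d ℕ.+ n))
    c = 1# ∷ ((λ i → - z i) ++ (λ j → - m j))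
    σ : SubdivisionCell V
    σ = face (liftedPolytope V) c , c , (0≤1 , 0≉1) , (λ p → p) , (λ p → p)
    height : (v : Finite (V i j)) → c · lift V i j v ≈ cost z v - m j
    height {i} {j} v = begin-equality
      c · lift V i j v
        ≈⟨ +-cong (*-identityˡ _) (·-vertex-++ (λ i → - z i) (λ j → - m j) i j) ⟩
      value v + (- z i - m j)
        ≈⟨ +-assoc _ _ _ ⟨
      cost z v - m j
        ∎
    height≥0 : ∀ {s} → s ∈ Lifted → 0# ≤ c · s
    height≥0 {s} (i , j , w , s≋) = begin
      0#                ≤⟨ x≤y⇒0≤y-x (m-min j w) ⟩
      cost z w - m j    ≈⟨ height w ⟨
      c · lift V i j w  ≈⟨ ·-congʳ c s≋ ⟨
      c · s             ∎
    graph⇒covector : ∀ ij → ij ∈ graph σ → ij ∈ covector z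
    graph⇒covector (i , j) (v , _ , lift-min) = v , λ w → ≤-trans v≤m (m-min j w)
      where
      v* = proj₁ (proj₂ (nonisolated j))
      v≤m : cost z v ≤ m j
      v≤m = +-cancelʳ-≤ (- m j) (begin
        cost z v - m j     ≈⟨ height v ⟨
        c · lift V i j v   ≤⟨ lift-min (lift∈P v*) ⟩
        c · lift V _ j v*  ≈⟨ height v* ⟩
        m j - m j          ∎)
    covector⇒graph : ∀ ij → ij ∈ covector z → ij ∈ graph σ
    covector⇒graph (i , j) (v , v-min) = v , lift∈P v , P.conv-≥ c (λ s∈ → ≤-trans (begin
      c · lift V i j v   ≈⟨ height v ⟩
      cost z v - m j     ≤⟨ +-mono-≤ (v-min (proj₁ (proj₂ (nonisolated j)))) ≤-refl ⟩
      m j - m j          ≈⟨ -‿inverseʳ (m j) ⟩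
      0#                 ∎) (height≥0 s∈))

  -- Cells of the subdivision compared by their graphs.

  lower-face-support :
    (σ : SubdivisionCell V) →
    ∀ {r} {w : Fin r → ℝ} {v : Fin r → ℝ^ (suc (d ℕ.+ n))} {y} →
    (∀ t → v t ∈ Lifted) → (∀ t → 0# ≤ w t) → sum w ≈ 1# →
    y ≋ combination w v → y ∈ proj₁ σ →
    ∀ t → ¬ w t ≈ 0# →
    ∃[ i ] ∃[ j ] Σ[ ij∈ ∈ (i , j) ∈ graph σ ] v t ≋ lift V i j (proj₁ ij∈)
  lower-face-support (_ , c , _ , F⊆ , ⊆F) v∈ 0≤w ∑w≈1 y≋ y∈F t w≉0 =
    let i , j , b , v≋ = v∈ t in
    i , j ,
    (b , ⊆F (P.face-resp-≋ c v≋ (P.face-support c v∈ 0≤w ∑w≈1 y≋ (F⊆ y∈F) t w≉0))) , v≋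

  -- The lifted points of nonzero weight that combine to a point of the face of `σ` belong to its
  -- graph, hence lie on the face of `τ`.
  cell-mono : (σ τ : SubdivisionCell V) → graph σ ⊆ graph τ → cell σ ⊆ cell τ
  cell-mono σ@(_ , _ , _ , F⊆ , _) τ@(_ , c , _ , F′⊆ , ⊆F′) σ⊆τ (y , y∈F , x≋)
    with y∈P@(r , v , w , v∈ , 0≤w , ∑w≈1 , y≋) ← proj₁ (F⊆ y∈F) =
    y , ⊆F′ (P.combination∈face c 0≤w ∑w≈1 y∈P y≋ v∈face) , x≋
    where
    v∈face : ∀ t → ¬ w t ≈ 0# → v t ∈ face (liftedPolytope V) c
    v∈face t w≉0 =
      let i , j , ij∈σ , v≋ = lower-face-support σ v∈ 0≤w ∑w≈1 y≋ y∈F t w≉0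
      in P.face-resp-≋ c (≋-sym v≋) (F′⊆ (graph⇒lift∈ τ (σ⊆τ ij∈σ) (proj₁ ij∈σ)))

  -- The vertex `(i , j)` lies in the cell of `τ`, a priori at another height. As it is extreme,
  -- every lifted point of nonzero weight in a combination projecting to it sits over the same
  -- vertex.
  cell-cancel : (σ τ : SubdivisionCell V) → cell σ ⊆ cell τ → graph σ ⊆ graph τ
  cell-cancel σ τ@(_ , _ , _ , F′⊆ , _) σ⊆τ {i , j} (b , lift∈F)
    with y , y∈F′ , x≋ ← σ⊆τ (lift V i j b , lift∈F , λ _ → refl)
    with r , v , w , v∈ , 0≤w , ∑w≈1 , y≋ ← proj₁ (F′⊆ y∈F′)
    with t , w≉0 ← some-weight≉0 ∑w≈1
    with i′ , j′ , ij∈τ , v≋ ← lower-face-support τ v∈ 0≤w ∑w≈1 y≋ y∈F′ t w≉0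
    = ≡.subst₂ (λ i j → (i , j) ∈ graph τ)
        (1≤e⇒≡ (≤-trans (extremal (i ↑ˡ n) vertex-↑ˡ)
          (≤-reflexive (reflexive (lookup-++ˡ (e i′) (e j′) i)))))
        (1≤e⇒≡ (≤-trans (extremal (d ↑ʳ j) vertex-↑ʳ)
          (≤-reflexive (reflexive (lookup-++ʳ (e i′) (e j′) j)))))
        ij∈τ
    where
    vertex-↑ˡ : vertex i j (i ↑ˡ n) ≈ 1#
    vertex-↑ˡ = trans (reflexive (lookup-++ˡ (e i) (e j) i)) (e-diagonal i)
    vertex-↑ʳ : vertex i j (d ↑ʳ j) ≈ 1#
    vertex-↑ʳ = trans (reflexive (lookup-++ʳ (e i) (e j) j)) (e-diagonal j)
    -- Each coordinate of a vertex is at most 1, so where a convex combination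
    -- has coordinate 1, so do the points with nonzero weight.
    extremal : ∀ k → vertex i j k ≈ 1# → 1# ≤ vertex i′ j′ k
    extremal k ≈1 = ≤-trans (weighted-tight 0≤w v≤1 (begin
      sum (λ t → w t * 1#)           ≈⟨ weighted-const w ∑w≈1 1# ⟩
      1#                             ≈⟨ ≈1 ⟨
      vertex i j k                   ≈⟨ x≋ k ⟩
      y (suc k)                      ≈⟨ y≋ (suc k) ⟩
      sum (λ t → w t * v t (suc k))  ∎) t w≉0) (≤-reflexive (v≋ (suc k)))
      where
      v≤1 : ∀ t → v t (suc k) ≤ 1#
      v≤1 t = let i , j , b , v≋ = v∈ t in
        ≤-trans (≤-reflexive (v≋ (suc k))) (vertex≤1 i j k)

  -- Interior cells and the boundary of the product of simplices.

  Vertices : Pred (ℝ^ (d ℕ.+ n)) 0ℓ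
  Vertices x = ∃[ i ] ∃[ j ] x ≋ vertex i j

  module Δ = Convex Vertices

  vertex∈Δ×Δ : ∀ i j → vertex i j ∈ Δ×Δ d n
  vertex∈Δ×Δ i j = Δ.∈⇒∈conv (i , j , λ _ → refl)

  -- `c` vanishes on the cell, so its minimum over `Δ×Δ` is attained there; being positive at some
  -- vertex, it cuts out a proper face.
  nonneg-functional⇒boundary :
    (σ : SubdivisionCell V) (c : ℝ^ (d ℕ.+ n)) →
    (∀ i j → 0# ≤ c · vertex i j) →
    (∀ i j → (i , j) ∈ graph σ → c · vertex i j ≈ 0#) →
    (∃[ i ] ∃[ j ] ¬ c · vertex i j ≤ 0#) →
    cell σ ⊆ ∂ (Δ×Δ d n)
  nonneg-functional⇒boundary σ@(F , c′ , _ , F⊆ , _) c c≥0 c≈0 (i₀ , j₀ , c≰0) {x} (y , y∈F , x≋)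
    with r , v , w , v∈ , 0≤w , ∑w≈1 , y≋ ← proj₁ (F⊆ y∈F) =
    c , (x∈Δ , λ z∈Δ → ≤-trans c·x≤0 (Δ.conv-≥ c c≥0′ z∈Δ)) ,
    λ Δ⊆face → c≰0 (≤-trans (proj₂ (Δ⊆face (vertex∈Δ×Δ i₀ j₀)) x∈Δ) c·x≤0)
    where
    x≋comb : x ≋ combination w (λ t → tail (v t))
    x≋comb k = trans (x≋ k) (y≋ (suc k))
    x∈Δ : x ∈ Δ×Δ d n
    x∈Δ = r , (λ t → tail (v t)) , w ,
      (λ t → let i , j , _ , v≋ = v∈ t in i , j , λ k → v≋ (suc k)) , 0≤w , ∑w≈1 , x≋comb
    c≥0′ : ∀ {s} → s ∈ Vertices → 0# ≤ c · s
    c≥0′ (i , j , s≋) = ≤-trans (c≥0 i j) (≤-reflexive (·-congʳ c (≋-sym s≋)))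
    c·x≤0 : c · x ≤ 0#
    c·x≤0 = begin
      c · x                                    ≈⟨ ·-congʳ c x≋comb ⟩
      c · combination w (λ t → tail (v t))     ≈⟨ ·-combination c w (λ t → tail (v t)) ⟩
      sum (λ t → w t * (c · tail (v t)))       ≤⟨ weighted-mono-≤ 0≤w (λ t w≉0 →
        let i , j , ij∈σ , v≋ = lower-face-support σ v∈ 0≤w ∑w≈1 y≋ y∈F t w≉0 in
        ≤-reflexive (trans (·-congʳ c (λ k → v≋ (suc k))) (c≈0 i j ij∈σ))) ⟩
      sum (λ t → w t * 0#)                     ≈⟨ weighted-const w ∑w≈1 0# ⟩
      0#                                       ∎

  -- If `j` is isolated, the `j`-th coordinate of the second simplex is a nonnegative functional
  -- vanishing on the cell.
  interior⇒noIsolatedNodeʳ : (∀ j → ∃[ i ] (i , j) ∈ B V) →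
                             (σ : SubdivisionCell V) → σ ∈ Interior V → NoIsolatedNodeʳ (graph σ)
  interior⇒noIsolatedNodeʳ nonempty σ interior j
    with excludedMiddle (∃[ i ] (i , j) ∈ graph σ)
  ... | yes found = found
  ... | no isolated = ⊥-elim (interior (nonneg-functional⇒boundary σ c
      (λ i j′ → ≤-trans (0≤e j j′) (≤-reflexive (sym (value-at i j′))))
      (λ i j′ ij′∈σ → trans (value-at i j′)
        (i≢k⇒e≈0 j j′ (λ { ≡.refl → isolated (i , ij′∈σ) })))
      (proj₁ (nonempty j) , j , λ ≤0 → 0≉1 (antisym 0≤1
        (≤-trans (≤-reflexive (sym (trans (value-at (proj₁ (nonempty j)) j) (e-diagonal j)))) ≤0)))))
    where
    c : ℝ^ (d ℕ.+ n)
    c = (λ _ → 0#) ++ e j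
    value-at : ∀ i j′ → c · vertex i j′ ≈ e j j′
    value-at i j′ = trans (·-vertex-++ (λ _ → 0#) (e j) i j′) (+-identityˡ _)

  -- Here the functional is the `i`-th coordinate of the first simplex; `j₀` gives a vertex where it
  -- is 1.
  interior⇒noIsolatedNodeˡ : Fin n → (σ : SubdivisionCell V) →
                             σ ∈ Interior V → NoIsolatedNodeˡ (graph σ)
  interior⇒noIsolatedNodeˡ j₀ σ interior i
    with excludedMiddle (∃[ j ] (i , j) ∈ graph σ)
  ... | yes found = found
  ... | no isolated = ⊥-elim (interior (nonneg-functional⇒boundary σ c
      (λ i′ j → ≤-trans (0≤e i i′) (≤-reflexive (sym (value-at i′ j))))
      (λ i′ j i′j∈σ → trans (value-at i′ j)
        (i≢k⇒e≈0 i i′ (λ { ≡.refl → isolated (j , i′j∈σ) })))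
      (i , j₀ , λ ≤0 → 0≉1 (antisym 0≤1
        (≤-trans (≤-reflexive (sym (trans (value-at i j₀) (e-diagonal i)))) ≤0)))))
    where
    c : ℝ^ (d ℕ.+ n)
    c = e i ++ (λ _ → 0#)
    value-at : ∀ i′ j → c · vertex i′ j ≈ e i i′
    value-at i′ j = trans (·-vertex-++ (e i) (λ _ → 0#) i′ j) (+-identityʳ _)

  -- If (i , l) and (r , j) lie on a face of Δ×Δ, then so does (i , j), because
  -- (i , j) + (r , l) = (i , l) + (r , j).
  vertex∈face : ∀ c i j l r →
    vertex i l ∈ face (Δ×Δ d n) c → vertex r j ∈ face (Δ×Δ d n) c →
    vertex i j ∈ face (Δ×Δ d n) c
  vertex∈face c i j l r (_ , il-min) (_ , rj-min) =
    vertex∈Δ×Δ i j , λ {y} y∈Δ → +-cancelʳ-≤ (c · vertex r l) (begin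
      c · vertex i j + c · vertex r l  ≈⟨ +-cong (·-vertex c i j) (·-vertex c r l) ⟩
      (a i + b j) + (a r + b l)        ≈⟨ +-congˡ (+-comm _ _) ⟩
      (a i + b j) + (b l + a r)        ≈⟨ interchange _ _ _ _ ⟩
      (a i + b l) + (b j + a r)        ≈⟨ +-congˡ (+-comm _ _) ⟩
      (a i + b l) + (a r + b j)        ≈⟨ +-cong (·-vertex c i l) (·-vertex c r j) ⟨
      c · vertex i l + c · vertex r j  ≤⟨ +-mono-≤ (il-min y∈Δ) (rj-min (vertex∈Δ×Δ r l)) ⟩
      c · y + c · vertex r l           ∎)
    where
    a : ℝ^ d
    a i = c (i ↑ˡ n)
    b : ℝ^ n
    b j = c (d ↑ʳ j)

  -- Since no node is isolated, a face of Δ×Δ that contains the average of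
  -- (i , neighbourˡ i) and (neighbourʳ j , j) over all i and j is Δ×Δ itself.
  noIsolatedNode⇒interior : Fin n → (σ : SubdivisionCell V) →
    NoIsolatedNodeʳ (graph σ) → NoIsolatedNodeˡ (graph σ) → σ ∈ Interior V
  noIsolatedNode⇒interior j₀ σ@(F , c′ , _ , F⊆ , ⊆F) neighbourʳ neighbourˡ σ⊆∂ = Δ⊈face Δ⊆face
    where
    open Weights (uniform (d ℕ.+ n))
    Edge : Set
    Edge = Σ[ ij ∈ Fin d × Fin n ] ij ∈ graph σ
    edgeˡ : Fin d → Edge
    edgeˡ i = (i , proj₁ (neighbourˡ i)) , proj₂ (neighbourˡ i)
    edgeʳ : Fin n → Edge
    edgeʳ j = (proj₁ (neighbourʳ j) , j) , proj₂ (neighbourʳ j)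
    edges : Fin (suc (d ℕ.+ n)) → Edge
    -- The extra leading edge makes the length a successor, as `uniform` requires.
    edges = edgeʳ j₀ ∷ (edgeˡ ++ edgeʳ)
    vertexₑ : Edge → ℝ^ (d ℕ.+ n)
    vertexₑ ((i , j) , _) = vertex i j
    liftₑ : Edge → ℝ^ (suc (d ℕ.+ n))
    liftₑ ((i , j) , (b , _)) = lift V i j b
    y : ℝ^ (suc (d ℕ.+ n))
    y = combination weight (λ t → liftₑ (edges t))
    y∈F : y ∈ F
    y∈F = ⊆F (P.combination∈face c′ nonneg total≈1
      (_ , _ , weight , (λ t → lift∈Lifted (proj₁ (proj₂ (edges t)))) ,
        nonneg , total≈1 , λ _ → refl)
      (λ _ → refl) (λ t _ → F⊆ (proj₂ (proj₂ (edges t)))))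
    y∈∂ = σ⊆∂ {tail y} (y , y∈F , λ _ → refl)
    c = proj₁ y∈∂
    Δ⊈face = proj₂ (proj₂ y∈∂)
    edge∈face : ∀ t → vertexₑ (edges t) ∈ face (Δ×Δ d n) c
    edge∈face t = Δ.face-support c {v = λ t → vertexₑ (edges t)}
      (λ t → let (i , j) , _ = edges t in i , j , λ _ → refl)
      nonneg total≈1 (λ _ → refl) (proj₁ (proj₂ y∈∂)) t (weight≉0 t)
    all∈face : ∀ i j → vertex i j ∈ face (Δ×Δ d n) c
    all∈face i j = vertex∈face c i j (proj₁ (neighbourˡ i)) (proj₁ (neighbourʳ j))
      (≡.subst (λ ε → vertexₑ ε ∈ face (Δ×Δ d n) c)
        (lookup-++ˡ edgeˡ edgeʳ i) (edge∈face (suc (i ↑ˡ n))))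
      (≡.subst (λ ε → vertexₑ ε ∈ face (Δ×Δ d n) c)
        (lookup-++ʳ edgeˡ edgeʳ j) (edge∈face (suc (d ↑ʳ j))))
    Δ⊆face : Δ×Δ d n ⊆ face (Δ×Δ d n) c
    Δ⊆face x∈Δ@(r , v , w , v∈ , 0≤w , ∑w≈1 , x≋) = Δ.combination∈face c 0≤w ∑w≈1 x∈Δ x≋
      (λ t _ → let i , j , v≋ = v∈ t in Δ.face-resp-≋ c (≋-sym v≋) (all∈face i j))

  -- Points of the tropical cone.

  tcone⇒noIsolatedNodeˡ : ∀ {z} → (λ i → [ z i ]) ∈ tcone V → NoIsolatedNodeˡ (covector z)
  tcone⇒noIsolatedNodeˡ {z} (c , z≈) i
    -- Column `j` attains the minimum in row `i`, so `z i` is `a + value v`, while every `z ℓ` is at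
    -- most `a + value w`. Hence `value v - z i`, which is `- a`, is minimal in the column.
    with j , cⱼ⊙vᵢⱼ≈zᵢ ← ⨁-attained (λ j → c j ⊙ V i j) (𝕋.Eq.sym (z≈ i))
    with a , cⱼ≡a , v , a+v≈zᵢ ← ⊙-finite (c j) cⱼ⊙vᵢⱼ≈zᵢ
    = j , v , λ {ℓ} w → x-y≤z-w⇒w-y≤z-x (x+w≤z+y⇒x-y≤z-w (begin
      z ℓ + value v            ≤⟨ +-mono-≤ (zₗ≤ w) ≤-refl ⟩
      a + value w + value v    ≈⟨ +-congʳ (+-comm a (value w)) ⟩
      value w + a + value v    ≈⟨ +-assoc _ _ _ ⟩
      value w + (a + value v)  ≈⟨ +-congˡ a+v≈zᵢ ⟩
      value w + z i            ∎))
    where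
    zₗ≤ : ∀ {ℓ} (w : Finite (V ℓ j)) → z ℓ ≤ a + value w
    zₗ≤ {ℓ} w = [≤]-injective (𝕋.trans (𝕋.reflexive (z≈ ℓ))
      (𝕋.trans (⨁-≤ (λ j → c j ⊙ V ℓ j) j)
        (𝕋.reflexive (𝕋.Eq.reflexive
          (≡.trans (≡.cong (_⊙ V ℓ j) cⱼ≡a) ([]⊙-value w))))))

  -- `- m j` is the least coefficient that keeps column `j` above `z`; row `i` becomes an equality
  -- in any column adjacent to `i`.
  noIsolatedNode⇒tcone : ∀ {z} → NoIsolatedNodeʳ (covector z) → NoIsolatedNodeˡ (covector z) →
                         (λ i → [ z i ]) ∈ tcone V
  noIsolatedNode⇒tcone {z} neighbourʳ neighbourˡ = (λ j → [ - m j ]) , λ i →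
    𝕋.antisym (≤-⨁ (λ j → [ - m j ] ⊙ V i j) (λ j → below j (V i j) (m-min j)))
      (𝕋.trans (⨁-≤ (λ j → [ - m j ] ⊙ V i j) (proj₁ (neighbourˡ i)))
        (above i (proj₁ (neighbourˡ i)) (proj₂ (neighbourˡ i))))
    where
    m : ℝ^ n
    m j = cost z (proj₁ (proj₂ (neighbourʳ j)))
    m-min : ∀ j {i} (w : Finite (V i j)) → m j ≤ value w - z i
    m-min j w = proj₂ (proj₂ (neighbourʳ j)) w
    below : ∀ j {i} (t : 𝕋) → ((w : Finite t) → m j ≤ value w - z i) →
            [ z i ] 𝕋.≤ [ - m j ] ⊙ t
    below j ∞ _ = _ ≤⊤⁺
    below j [ v ] m≤ = [ ≤-trans (x≤y-z⇒z≤y-x (m≤ (Maybe.just _))) (≤-reflexive (+-comm _ _)) ]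
    above : ∀ i j → (i , j) ∈ covector z → [ - m j ] ⊙ V i j 𝕋.≤ [ z i ]
    above i j (v , v-min) = 𝕋.trans (𝕋.reflexive (𝕋.Eq.reflexive ([]⊙-value v)))
      [ ≤-trans (≤-reflexive (+-comm _ _))
          (x-y≤z⇒x-z≤y (v-min (proj₁ (proj₂ (neighbourʳ j))))) ]

  -- The duality.

  X-cell : (σ : SubdivisionCell V) → NoIsolatedColumn V σ → CovectorCell V
  X-cell σ nonisolated = X[ σ ] ,
    X-covectorCell (graph σ) (graph⊆B σ) nonisolated
      (z , ⊆covector⇒X σ (λ {ij} → proj₁ σ≐z {ij}))
    where
    z   = proj₁ (cell-point σ nonisolated)
    σ≐z = proj₂ (cell-point σ nonisolated)

  -- The point given by `cell-point` has covector exactly `graph τ`, so it lies in `X[ τ ]`, hence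
  -- in `X[ σ ]`, and its covector contains `graph σ`.
  X-cancel : (σ τ : SubdivisionCell V) → NoIsolatedColumn V τ →
             X[ τ ] ⊆ X[ σ ] → graph σ ⊆ graph τ
  X-cancel σ τ nonisolated Xτ⊆Xσ ij∈σ =
    let z , τ⊆z , z⊆τ = cell-point τ nonisolated
    in z⊆τ (X⇒⊆covector σ (Xτ⊆Xσ (⊆covector⇒X τ (λ {ij} → τ⊆z {ij}))) ij∈σ)

  X-mono : (σ τ : SubdivisionCell V) → graph σ ⊆ graph τ →
           X[ τ ] ⊆ X[ σ ]
  X-mono σ τ σ⊆τ z∈X = ⊆covector⇒X σ (λ ij∈σ → X⇒⊆covector τ z∈X (σ⊆τ ij∈σ))

  -- A generic point of `D` has a covector contained in that of every point of `D`; the lower face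
  -- with this graph therefore gives back `D`.
  X-surjective : (D : CovectorCell V) →
    Σ[ σ ∈ SubdivisionCell V ] NoIsolatedColumn V σ × X[ σ ] ≐ proj₁ D
  X-surjective D@(_ , (_ , z₀∈D) , _) =
    let G , nonisolated , D⊆ , ⊆D = covectorCell-graph D
        z , G⊆z , z-min = generic-point nonisolated (λ {ij} → D⊆ z₀∈D {ij})
        σ , σ⊆z , z⊆σ = point-cell z (λ j → _ , G⊆z (proj₂ (nonisolated j)))
    in σ , (λ j → _ , z⊆σ (G⊆z (proj₂ (nonisolated j)))) ,
       (λ x∈X → ⊆D (λ ij∈G → X⇒⊆covector σ x∈X (z⊆σ (G⊆z ij∈G)))) ,
       (λ x∈D → ⊆covector⇒X σ (λ ij∈σ → z-min (λ {ij} → D⊆ x∈D {ij}) (σ⊆z ij∈σ)))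

  -- On cells without isolated columns, inclusion of cells, inclusion of graphs and reverse
  -- inclusion of the sets `X[ σ ]` are equivalent, so it remains to match `P` with `Q`.
  dual : {Q : Pred (CovectorCell V) 0ℓ} {P : Pred (SubdivisionCell V) 0ℓ} →
    (P⊆ : P ⊆ NoIsolatedColumn V) →
    (∀ σ (p : σ ∈ P) → X-cell σ (P⊆ p) ∈ Q) →
    (∀ D σ → NoIsolatedColumn V σ → X[ σ ] ≐ proj₁ D → D ∈ Q → σ ∈ P) →
    Dual V Q P
  dual P⊆ P⇒Q Q⇒P =
    (λ (σ , p) → X-cell σ (P⊆ p) , P⇒Q σ p) ,
    (λ _ → (λ x∈ → x∈) , (λ x∈ → x∈)) ,
    record
      { isOrderMonomorphism = record
        { isOrderHomomorphism = record
          { cong = λ {σ} {τ} (σ⊆τ , τ⊆σ) → mono τ σ τ⊆σ , mono σ τ σ⊆τ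
          ; mono = λ {σ} {τ} → mono σ τ
          }
        ; injective = λ {σ} {τ} (Xσ⊆Xτ , Xτ⊆Xσ) → cancel σ τ Xτ⊆Xσ , cancel τ σ Xσ⊆Xτ
        ; cancel = λ {σ} {τ} → cancel σ τ
        }
      ; surjective = λ (D , q) →
          let σ , nonisolated , X≐D = X-surjective D
              p = Q⇒P D σ nonisolated X≐D q
          -- Surjectivity respects equality of cells: every `τ` with the same cell as `σ` has to be
          -- sent to `D` too.
          in (σ , p) , λ {τ} (τ⊆σ , σ⊆τ) →
               (λ x∈ → proj₁ X≐D (mono (σ , p) τ σ⊆τ x∈)) ,
               (λ x∈ → mono τ (σ , p) τ⊆σ (proj₂ X≐D x∈))
      }
    where
    mono : ∀ σ τ → cell (proj₁ σ) ⊆ cell (proj₁ τ) →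
           X[ proj₁ τ ] ⊆ X[ proj₁ σ ]
    mono (σ , _) (τ , _) σ⊆τ = X-mono σ τ (cell-cancel σ τ σ⊆τ)
    cancel : ∀ σ τ →
             X[ proj₁ τ ] ⊆ X[ proj₁ σ ] →
             cell (proj₁ σ) ⊆ cell (proj₁ τ)
    cancel (σ , _) (τ , p) Xτ⊆Xσ = cell-mono σ τ (X-cancel σ τ (P⊆ p) Xτ⊆Xσ)

  -- Covectors of points of `X[ σ ]` contain the graph, and adding edges isolates no node.
  interior⇒X⊆tcone : Fin n → (σ : SubdivisionCell V) (nonisolated : NoIsolatedColumn V σ) →
                     σ ∈ Interior V → X-cell σ nonisolated ∈ InTcone V
  interior⇒X⊆tcone j₀ σ nonisolated interior z∈X = noIsolatedNode⇒tcone
    (λ j → _ , σ⊆z (proj₂ (nonisolated j)))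
    (λ i → _ , σ⊆z (proj₂ (interior⇒noIsolatedNodeˡ j₀ σ interior i)))
    where
    σ⊆z = λ {ij} → X⇒⊆covector σ z∈X {ij}

  -- One point suffices: the point given by `cell-point` has `graph σ` itself as covector, so its
  -- membership in the cone yields an edge at each row.
  X⊆tcone⇒interior : Fin n → (D : CovectorCell V) (σ : SubdivisionCell V) →
    NoIsolatedColumn V σ → X[ σ ] ≐ proj₁ D → D ∈ InTcone V → σ ∈ Interior V
  X⊆tcone⇒interior j₀ D σ nonisolated (X⊆D , _) D⊆tcone
    with z , σ⊆z , z⊆σ ← cell-point σ nonisolated =
    noIsolatedNode⇒interior j₀ σ nonisolated λ i →
      let j , ij∈z = tcone⇒noIsolatedNodeˡ (D⊆tcone (X⊆D (⊆covector⇒X σ (λ {ij} → σ⊆z {ij})))) i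
      in j , z⊆σ ij∈z

corollary34 : (R : Reals) → let open TropicalConvexity R in
    (d n : ℕ) → .{{_ : NonZero n}} → (V : Matrix d n) →
    (∀ j → ∃[ i ] (i , j) ∈ B V) →
    Dual V U (NoIsolatedColumn V) ×
    Interior V ⊆ NoIsolatedColumn V ×
    Dual V (InTcone V) (Interior V)
-- As there is a column, `zero` can serve as `j₀`.
corollary34 R d (suc n) V nonempty =
  dual (λ p → p) _ (λ _ _ nonisolated _ _ → nonisolated) ,
  (λ {σ} → interior⇒noIsolatedNodeʳ nonempty σ) ,
  dual (λ {σ} → interior⇒noIsolatedNodeʳ nonempty σ)
    (λ σ interior {z} →
      interior⇒X⊆tcone zero σ (interior⇒noIsolatedNodeʳ nonempty σ interior) interior {z})
    (λ D σ nonisolated X≐D D⊆tcone →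
      X⊆tcone⇒interior zero D σ nonisolated X≐D (λ {z} → D⊆tcone {z}))
  where open Structure R V
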